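{- Let $\mathcal{D}$ be the set of partitions into distinct parts and $\mathcal{U}$ the set of all partitions. As formal power series in $q$, $$\sum_{\pi\in\mathcal{D}} \widetilde{\omega}_1(\pi)\, q^{|\pi|} = \sum_{\pi\in\mathcal{U}} \omega_1'(\pi)\, q^{|\pi|},$$ where, for $\pi=(\lambda_1,\lambda_2,\dots,\lambda_{\nu(\pi)})$ and with the convention $\lambda_{\nu(\pi)+1}:=-1/2$, $$\widetilde{\omega}_1(\pi)=\prod_{i=1}^{\nu(\pi)}(2\lambda_i-2\lambda_{i+1}-1),$$ and $\omega_1'(\pi)=2^{\nu_d(\pi)}$, with $\nu_d(\pi)$ the number of different parts of $\pi$.
   Context: A partition $\pi=(\lambda_1,\lambda_2,\dots,\lambda_{\nu(\pi)})$ is a finite non-increasing sequence of positive integers (its parts); $\nu(\pi)$ is the number of parts and $|\pi|$ is the sum of the parts. The empty sequence is the unique partition of $0$, and it belongs to both $\mathcal{D}$ and $\mathcal{U}$. $\nu_d(\pi)$ counts the distinct values among the parts of $\pi$ (without multiplicity). Empty products equal $1$. -}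

module Defs where

open import Data.Integer.Base using (+_)
open import Data.List.Base
  using (List; []; _∷_; map; foldr; length; filter; upTo; deduplicate; cartesianProductWith)
open import Data.List.Membership.Propositional using (_∈_)
open import Data.List.Membership.Propositional.Properties
  using (∈-map⁺; ∈-upTo⁺; ∈-cartesianProductWith⁺; ∈-cartesianProductWith⁻; ∈-filter⁺; ∈-filter⁻)
open import Data.List.Properties using (∷-injective)
open import Data.List.Relation.Unary.All as All using (All; []; _∷_)
import Data.List.Relation.Unary.AllPairs as AllPairs
open import Data.List.Relation.Unary.Any using (here; there)
open import Data.List.Relation.Unary.Linked using (Linked; linked?)
open import Data.List.Relation.Unary.Unique.Propositional using (Unique)
import Data.List.Relation.Unary.Unique.Propositional.Properties as Unique
import Data.List.Relation.Unary.Unique.DecPropositional as DecUnique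
open import Data.Nat.Base using (ℕ; zero; suc; _≤_; _<_; _≥_; _^_; s≤s)
open import Data.Nat.ListAction using (sum)
open import Data.Nat.Properties
  using (_≟_; _<?_; _≥?_; ≤-refl; ≤-trans; m≤m+n; m≤n+m; suc-injective)
open import Data.Product.Base using (_×_; _,_; proj₁; proj₂)
open import Data.Rational.Base using (ℚ; _/_; _+_; _-_; _*_; 0ℚ; 1ℚ; -½)
open import Function.Bundles using (_⇔_; mk⇔)
open import Level using (0ℓ)
open import Relation.Binary.PropositionalEquality using (_≡_; refl)
open import Relation.Nullary.Decidable using (_×-dec_)
open import Relation.Unary using (Pred; Decidable; _⊆_)

𝒰 : Pred (List ℕ) 0ℓ
𝒰 π = All (0 <_) π × Linked _≥_ π

𝒟 : Pred (List ℕ) 0ℓ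
𝒟 π = 𝒰 π × Unique π

𝒰? : Decidable 𝒰
𝒰? π = All.all? (0 <?_) π ×-dec linked? _≥?_ π

𝒟? : Decidable 𝒟
𝒟? π = 𝒰? π ×-dec DecUnique.unique? _≟_ π

∣_∣ : List ℕ → ℕ
∣_∣ = sum

ν-d : List ℕ → ℕ
ν-d π = length (deduplicate _≟_ π)

fromℕ : ℕ → ℚ
fromℕ n = + n / 1

-- The part following a given one, where the list holds the remaining parts:
-- past the last part, the convention is λ_{ν(π)+1} = -1/2.
nextPart : List ℕ → ℚ
nextPart []      = -½
nextPart (l ∷ _) = fromℕ l

ω̃₁ : List ℕ → ℚ
ω̃₁ []      = 1ℚ
ω̃₁ (l ∷ π) = (fromℕ 2 * fromℕ l - fromℕ 2 * nextPart π - 1ℚ) * ω̃₁ π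

ω₁′ : List ℕ → ℚ
ω₁′ π = fromℕ (2 ^ ν-d π)

-- All lists of length at most k with entries in {1, …, b}.
boundedLists : ℕ → ℕ → List (List ℕ)
boundedLists zero    b = [] ∷ []
boundedLists (suc k) b =
  [] ∷ cartesianProductWith _∷_ (map suc (upTo b)) (boundedLists k b)

-- A partition of n has at most n parts, each at most n, so for a class C of
-- partitions nothing is missed; see ∈-ofSize below.
ofSize : {C : Pred (List ℕ) 0ℓ} → Decidable C → ℕ → List (List ℕ)
ofSize C? n = filter (λ π → C? π ×-dec (∣ π ∣ ≟ n)) (boundedLists n n)

-- A formal power series in q, given by its coefficients.
PowerSeries : Set
PowerSeries = ℕ → ℚ

-- The series Σ_{π ∈ C} w(π) q^|π|.
weightedSeries : {C : Pred (List ℕ) 0ℓ} → Decidable C → (List ℕ → ℚ) → PowerSeries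
weightedSeries C? w n = foldr _+_ 0ℚ (map w (ofSize C? n))

∈-boundedLists : ∀ k b {π} → All (0 <_) π → ∣ π ∣ ≤ k → ∣ π ∣ ≤ b → π ∈ boundedLists k b
∈-boundedLists zero    b []                    _       _ = here refl
∈-boundedLists zero    b (s≤s _ ∷ _)           ()      _
∈-boundedLists (suc k) b []                    _       _ = here refl
∈-boundedLists (suc k) b {suc x ∷ π} (_ ∷ pos) (s≤s p) q =
  there (∈-cartesianProductWith⁺ _∷_
    (∈-map⁺ suc (∈-upTo⁺ (≤-trans (m≤m+n (suc x) ∣ π ∣) q)))
    (∈-boundedLists k b pos (≤-trans (m≤n+m ∣ π ∣ x) p) (≤-trans (m≤n+m ∣ π ∣ (suc x)) q)))

boundedLists-unique : ∀ k b → Unique (boundedLists k b)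
boundedLists-unique zero    b = [] AllPairs.∷ AllPairs.[]
boundedLists-unique (suc k) b =
  All.tabulate (λ { y∈ refl → nonempty y∈ })
  AllPairs.∷
  Unique.cartesianProductWith⁺ _∷_ ∷-injective
    (Unique.map⁺ suc-injective (Unique.upTo⁺ b))
    (boundedLists-unique k b)
  where
  open import Data.Empty using (⊥)
  nonempty : [] ∈ cartesianProductWith _∷_ (map suc (upTo b)) (boundedLists k b) → ⊥
  nonempty p with ∈-cartesianProductWith⁻ _∷_ (map suc (upTo b)) (boundedLists k b) p
  ... | _ , _ , _ , _ , ()

∈-ofSize : ∀ {C : Pred (List ℕ) 0ℓ} (C? : Decidable C) → C ⊆ 𝒰 →
           ∀ n {π} → π ∈ ofSize C? n ⇔ (C π × ∣ π ∣ ≡ n)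
∈-ofSize C? C⊆𝒰 n = mk⇔
  (λ p → proj₂ (∈-filter⁻ (λ π → C? π ×-dec (∣ π ∣ ≟ n)) {xs = boundedLists n n} p))
  (λ { (c , refl) → ∈-filter⁺ (λ π → C? π ×-dec (∣ π ∣ ≟ n))
         (∈-boundedLists n n (proj₁ (C⊆𝒰 c)) ≤-refl ≤-refl) (c , refl) })

ofSize-unique : ∀ {C : Pred (List ℕ) 0ℓ} (C? : Decidable C) n → Unique (ofSize C? n)
ofSize-unique C? n =
  Unique.filter⁺ (λ π → C? π ×-dec (∣ π ∣ ≟ n)) (boundedLists-unique n n)

{-# OPTIONS --safe #-}

-- Let T_k and V_k be the series of partitions into k distinct parts, weighted by
-- ω̃₁ and by its variant with λ_{k+1} := 0.  Subtracting 1 from every part gives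
--   T_{k+1} = q^{k+1} (3 T_{k+1} − 2 V_{k+1} + 2 V_k),
--   V_{k+1} = q^{k+1} (2 T_{k+1} −   V_{k+1} +   V_k),
-- whence (1 + q^k) T_k = 2 V_k and (1 − q^{k+1})² T_{k+1} = q^{k+1} (1 + q^k) T_k.
-- Put S_N = Σ_{k≤N} (1 − q^N) ⋯ (1 − q^{N−k+1}) T_k, which agrees with Σ_k T_k up to
-- q^N.  The recurrence for T_k makes (1 − q^N) S_N − (1 + q^N) S_{N−1} telescope to 0
-- (a terminating q-Gauss sum), and the series of partitions with parts at most N,
-- weighted by ω₁′, satisfies the same recurrence in N with the same initial value.

module Submission where

open import Defs
import Data.Integer.Base as ℤ
import Data.Integer.Properties as ℤ
open import Data.List.Base
  using (List; []; _∷_; _∷ʳ_; map; foldr; length; filter; deduplicate)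
open import Data.List.Membership.Propositional using (_∈_)
open import Data.List.Membership.Propositional.Properties using (∈-map⁺; ∈-map⁻)
open import Data.List.Membership.Propositional.Properties.WithK using (unique∧set⇒bag)
open import Data.List.Properties
  using (filter-≐; filter-none; filter-all; filter-reject; filter-idem; map-cong-local; map-∘;
         map-id-local; map-injective; ∷-injectiveʳ; ∷ʳ-injectiveˡ; length-map; length-++)
open import Data.List.Relation.Binary.BagAndSetEquality using (∼bag⇒↭)
open import Data.List.Relation.Binary.Permutation.Propositional using (_↭_; ↭⇒↭ₛ)
import Data.List.Relation.Binary.Permutation.Propositional.Properties as ↭
import Data.List.Relation.Binary.Permutation.Setoid.Properties as ↭ₛ
open import Data.List.Relation.Unary.All as All using (All; []; _∷_)
import Data.List.Relation.Unary.All.Properties as All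
open import Data.List.Relation.Unary.AllPairs as AllPairs using (AllPairs; []; _∷_)
import Data.List.Relation.Unary.AllPairs.Properties as AllPairs
import Data.List.Relation.Unary.Linked as Linked
open import Data.List.Relation.Unary.Linked.Properties using (Linked⇒AllPairs; AllPairs⇒Linked)
import Data.List.Relation.Unary.Unique.Propositional.Properties as Unique
open import Data.Nat.Base as ℕ
  using (ℕ; zero; suc; pred; _≤_; _<_; _≥_; _>_; _∸_; _^_; z≤n; s≤s)
open import Data.Nat.Induction using (<-rec)
open import Data.Nat.ListAction.Properties using (sum-++)
import Data.Nat.Properties as ℕ
open import Data.Product.Base using (_×_; _,_; proj₁; proj₂; ∃)
open import Data.Rational.Base using (ℚ; _+_; _-_; _*_; 0ℚ; 1ℚ; -½; toℚᵘ)
import Data.Rational.Properties as ℚ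
open import Data.Rational.Solver using (module +-*-Solver)
open import Data.Rational.Unnormalised.Base as ℚᵘ using (mkℚᵘ)
import Data.Rational.Unnormalised.Properties as ℚᵘ
open import Function.Base using (_∘_; case_of_)
open import Function.Bundles using (mk⇔; Equivalence)
open import Function.Definitions using (Injective)
open import Level using (0ℓ)
open import Relation.Binary.PropositionalEquality
  using (_≡_; _≢_; _≗_; refl; sym; trans; cong; cong₂; subst; subst₂; setoid; module ≡-Reasoning)
open import Relation.Nullary using (¬_; yes; no; contradiction)
open import Relation.Nullary.Decidable using (_×-dec_; ¬?)
open import Relation.Unary using (Pred; Decidable; _⊆_; _∩_)
open import Relation.Unary.Properties using (_∩?_; ∁?)

open +-*-Solver using (solve; _:=_; _:+_; _:-_; _:*_; con)
open ≡-Reasoning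

-- Operators on power series: multiplication by q^j and by 1 ± q^j

-- Multiplication by q^j.
shift : ℕ → PowerSeries → PowerSeries
shift zero    a n       = a n
shift (suc j) a zero    = 0ℚ
shift (suc j) a (suc n) = shift j a n

-- Multiplication by 1 − q^j and by 1 + q^j.
Δ⁻ Δ⁺ : ℕ → PowerSeries → PowerSeries
Δ⁻ j a n = a n - shift j a n
Δ⁺ j a n = a n + shift j a n

-- Agreement is asked only up to `n`, which is what the strong induction in `Δ⁻-injective` can
-- supply.
shift-local : ∀ j {a b n} → (∀ {m} → m ≤ n → a m ≡ b m) → shift j a n ≡ shift j b n
shift-local zero    eq = eq ℕ.≤-refl
shift-local (suc j) {n = zero}  eq = refl
shift-local (suc j) {n = suc n} eq = shift-local j (eq ∘ ℕ.m≤n⇒m≤1+n)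

shift-cong : ∀ j {a b} → a ≗ b → shift j a ≗ shift j b
shift-cong j eq n = shift-local j λ {m} _ → eq m

shift-shift : ∀ i j a → shift i (shift j a) ≗ shift (i ℕ.+ j) a
shift-shift zero    j a n       = refl
shift-shift (suc i) j a zero    = refl
shift-shift (suc i) j a (suc n) = shift-shift i j a n

shift-+ : ∀ j a b → shift j (λ n → a n + b n) ≗ λ n → shift j a n + shift j b n
shift-+ zero    a b n       = refl
shift-+ (suc j) a b zero    = refl
shift-+ (suc j) a b (suc n) = shift-+ j a b n

shift-− : ∀ j a b → shift j (λ n → a n - b n) ≗ λ n → shift j a n - shift j b n
shift-− zero    a b n       = refl
shift-− (suc j) a b zero    = refl
shift-− (suc j) a b (suc n) = shift-− j a b n

shift-linear : ∀ j c a d b → shift j (λ n → c * a n + d * b n) ≗ λ n → c * shift j a n + d * shift j b n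
shift-linear zero    c a d b n       = refl
shift-linear (suc j) c a d b zero    = solve 2 (λ c d → con 0ℚ := c :* con 0ℚ :+ d :* con 0ℚ) refl c d
shift-linear (suc j) c a d b (suc n) = shift-linear j c a d b n

shift-+-cancel : ∀ j a n → shift j a (j ℕ.+ n) ≡ a n
shift-+-cancel zero    a n = refl
shift-+-cancel (suc j) a n = shift-+-cancel j a n

shift-comm : ∀ i j a → shift i (shift j a) ≗ shift j (shift i a)
shift-comm i j a n = begin
  shift i (shift j a) n  ≡⟨ shift-shift i j a n ⟩
  shift (i ℕ.+ j) a n    ≡⟨ cong (λ k → shift k a n) (ℕ.+-comm i j) ⟩
  shift (j ℕ.+ i) a n    ≡⟨ shift-shift j i a n ⟨
  shift j (shift i a) n  ∎

shift-vanish : ∀ j {k a n} → (∀ {m} → m < k → a m ≡ 0ℚ) → n < j ℕ.+ k → shift j a n ≡ 0ℚ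
shift-vanish zero                van n<k = van n<k
shift-vanish (suc j) {n = zero}  van _   = refl
shift-vanish (suc j) {n = suc n} van (s≤s n<j+k) = shift-vanish j van n<j+k

Δ⁻-cong : ∀ j {a b} → a ≗ b → Δ⁻ j a ≗ Δ⁻ j b
Δ⁻-cong j eq n = cong₂ _-_ (eq n) (shift-cong j eq n)

Δ⁺-cong : ∀ j {a b} → a ≗ b → Δ⁺ j a ≗ Δ⁺ j b
Δ⁺-cong j eq n = cong₂ _+_ (eq n) (shift-cong j eq n)

-- A factor 1 - q^i with i > 0 can be cancelled: coefficient `n` of the shifted series involves only
-- earlier coefficients, so strong induction recovers each coefficient in turn. For i = 0 the factor
-- would be zero, hence `suc j`.
Δ⁻-injective : ∀ j {a b} → Δ⁻ (suc j) a ≗ Δ⁻ (suc j) b → a ≗ b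
Δ⁻-injective j {a} {b} eq = <-rec (λ n → a n ≡ b n) step
  where
  cancel : ∀ {x y s t} → x - s ≡ y - t → s ≡ t → x ≡ y
  cancel {x} {y} {s} eq refl = begin
    x          ≡⟨ solve 2 (λ x s → x := x :- s :+ s) refl x s ⟩
    x - s + s  ≡⟨ cong (_+ s) eq ⟩
    y - s + s  ≡⟨ solve 2 (λ y s → y :- s :+ s := y) refl y s ⟩
    y          ∎

  earlier : ∀ n → (∀ {m} → m < n → a m ≡ b m) → shift (suc j) a n ≡ shift (suc j) b n
  earlier zero    rec = refl
  earlier (suc n) rec = shift-local j (rec ∘ s≤s)

  step : ∀ n → (∀ {m} → m < n → a m ≡ b m) → a n ≡ b n
  step n rec = cancel (eq n) (earlier n rec)

shift-Δ⁻ : ∀ i j a → shift i (Δ⁻ j a) ≗ Δ⁻ j (shift i a)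
shift-Δ⁻ i j a n = trans (shift-− i a (shift j a) n)
                        (cong (shift i a n -_) (shift-comm i j a n))

Δ⁻-comm : ∀ i j a → Δ⁻ i (Δ⁻ j a) ≗ Δ⁻ j (Δ⁻ i a)
Δ⁻-comm i j a n = begin
  Δ⁻ j a n - shift i (Δ⁻ j a) n                         ≡⟨ cong (Δ⁻ j a n -_) (shift-Δ⁻ i j a n) ⟩
  Δ⁻ j a n - Δ⁻ j (shift i a) n
    ≡⟨ solve 4 (λ x y z w → x :- y :- (z :- w) := x :- z :- (y :- w)) refl
         (a n) (shift j a n) (shift i a n) (shift j (shift i a) n) ⟩
  Δ⁻ i a n - (shift j a n - shift j (shift i a) n)      ≡⟨ cong (Δ⁻ i a n -_) (shift-− j a (shift i a) n) ⟨
  Δ⁻ i a n - shift j (Δ⁻ i a) n                         ∎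

Δ⁺-Δ⁻-comm : ∀ i j a → Δ⁺ i (Δ⁻ j a) ≗ Δ⁻ j (Δ⁺ i a)
Δ⁺-Δ⁻-comm i j a n = begin
  Δ⁻ j a n + shift i (Δ⁻ j a) n                         ≡⟨ cong (Δ⁻ j a n +_) (shift-Δ⁻ i j a n) ⟩
  Δ⁻ j a n + Δ⁻ j (shift i a) n
    ≡⟨ solve 4 (λ x y z w → x :- y :+ (z :- w) := x :+ z :- (y :+ w)) refl
         (a n) (shift j a n) (shift i a n) (shift j (shift i a) n) ⟩
  Δ⁺ i a n - (shift j a n + shift j (shift i a) n)      ≡⟨ cong (Δ⁺ i a n -_) (shift-+ j a (shift i a) n) ⟨
  Δ⁺ i a n - shift j (Δ⁺ i a) n                         ∎

-- Finite products of factors 1 - q^i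

-- ∏_{i<k} (1 − q^{N−i}); it vanishes for k > N, thanks to the factor 1 − q^0.
falling : ℕ → ℕ → PowerSeries → PowerSeries
falling N zero    a = a
falling N (suc k) a = Δ⁻ (N ∸ k) (falling N k a)

falling-cong : ∀ N k {a b} → a ≗ b → falling N k a ≗ falling N k b
falling-cong N zero    eq = eq
falling-cong N (suc k) eq = Δ⁻-cong (N ∸ k) (falling-cong N k eq)

-- Allows a recurrence for T_k to be applied underneath the product: `L` will be (1 - q^{k+1})² on
-- one side of the recurrence and q^{k+1} (1 + q^k) on the other.
falling-commute : (L : PowerSeries → PowerSeries) → (∀ {a b} → a ≗ b → L a ≗ L b) →
                  (∀ j a → L (Δ⁻ j a) ≗ Δ⁻ j (L a)) →
                  ∀ N k a → L (falling N k a) ≗ falling N k (L a)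
falling-commute L L-cong L-Δ⁻ N zero    a n = refl
falling-commute L L-cong L-Δ⁻ N (suc k) a n = trans
  (L-Δ⁻ (N ∸ k) (falling N k a) n)
  (Δ⁻-cong (N ∸ k) (falling-commute L L-cong L-Δ⁻ N k a) n)

-- The two products share the factors 1 - q^N, ..., 1 - q^{N-k+1}; the additional factor 1 - q^{N+1}
-- is applied first on the left and is commuted past the others.
falling-suc : ∀ N k a → falling (suc N) (suc k) a ≗ Δ⁻ (suc N) (falling N k a)
falling-suc N zero    a n = refl
falling-suc N (suc k) a n = begin
  Δ⁻ (N ∸ k) (falling (suc N) (suc k) a) n     ≡⟨ Δ⁻-cong (N ∸ k) (falling-suc N k a) n ⟩
  Δ⁻ (N ∸ k) (Δ⁻ (suc N) (falling N k a)) n    ≡⟨ Δ⁻-comm (N ∸ k) (suc N) (falling N k a) n ⟩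
  Δ⁻ (suc N) (Δ⁻ (N ∸ k) (falling N k a)) n    ∎

falling-vanish : ∀ N a n → falling N (suc N) a n ≡ 0ℚ
falling-vanish N a n rewrite ℕ.n∸n≡0 N = ℚ.+-inverseʳ (falling N N a n)

-- The series `a` begins at q^k or later, so a factor 1 - q^{N-j} with j < k can disturb it only
-- from q^{N-j+k} on, which lies beyond q^N.
falling-low : ∀ N k {a n} → (∀ {m} → m < k → a m ≡ 0ℚ) → k ≤ N → n ≤ N → falling N k a n ≡ a n
falling-low N k {a} van k≤N = go k ℕ.≤-refl
  where
  go : ∀ j {n} → j ≤ k → n ≤ N → falling N j a n ≡ a n
  go zero    j≤k n≤N = refl
  go (suc j) {n} j<k n≤N = begin
    falling N j a n - shift (N ∸ j) (falling N j a) n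
      ≡⟨ cong₂ _-_ (go j (ℕ.<⇒≤ j<k) n≤N)
           -- Vanishing below j + 1 suffices here, because (N - j) + (j + 1) = N + 1 > n.
           (shift-vanish (N ∸ j) {suc j}
             (λ m<1+j → let m<k = ℕ.≤-trans m<1+j j<k in
               trans (go j (ℕ.<⇒≤ j<k) (ℕ.<⇒≤ (ℕ.≤-trans m<k k≤N))) (van m<k))
             (subst (n <_) (sym (trans (ℕ.+-suc (N ∸ j) j)
               (cong suc (ℕ.m∸n+n≡m (ℕ.<⇒≤ (ℕ.≤-trans j<k k≤N)))))) (s≤s n≤N))) ⟩
    a n - 0ℚ  ≡⟨ ℚ.+-identityʳ (a n) ⟩
    a n       ∎

Δ⁻Δ⁻ : ∀ i j a n → Δ⁻ i (Δ⁻ j a) n ≡ (a n - shift j a n) - (shift i a n - shift (i ℕ.+ j) a n)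
Δ⁻Δ⁻ i j a n = cong (Δ⁻ j a n -_) (trans (shift-− i a (shift j a) n) (cong (shift i a n -_) (shift-shift i j a n)))

-- (1 − q^{d+j})² = (1 − q^{d+2j}) (1 − q^d) + q^d (1 − q^j)²
Δ⁻²-identity : ∀ d j a → Δ⁻ (d ℕ.+ j) (Δ⁻ (d ℕ.+ j) a) ≗
              λ n → Δ⁻ (d ℕ.+ j ℕ.+ j) (Δ⁻ d a) n + shift d (Δ⁻ j (Δ⁻ j a)) n
Δ⁻²-identity d j a n = begin
  Δ⁻ c (Δ⁻ c a) n
    ≡⟨ Δ⁻Δ⁻ c c a n ⟩
  (a n - shift c a n) - (shift c a n - shift (c ℕ.+ c) a n)
    ≡⟨ solve 5 (λ x y z w v → x :- y :- (y :- w) := (x :- z :- (v :- w)) :+ (z :- y :- (y :- v))) refl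
         (a n) (shift c a n) (shift d a n) (shift (c ℕ.+ c) a n) (shift (c ℕ.+ j) a n) ⟩
  ((a n - shift d a n) - (shift (c ℕ.+ j) a n - shift (c ℕ.+ c) a n))
    + ((shift d a n - shift c a n) - (shift c a n - shift (c ℕ.+ j) a n))
    ≡⟨ cong₂ _+_ (trans (cong (λ k → (a n - shift d a n) - (shift (c ℕ.+ j) a n - shift k a n)) c+c≡)
                        (sym (Δ⁻Δ⁻ (c ℕ.+ j) d a n)))
                 (sym right) ⟩
  Δ⁻ (c ℕ.+ j) (Δ⁻ d a) n + shift d (Δ⁻ j (Δ⁻ j a)) n  ∎
  where
  c = d ℕ.+ j
  c+c≡ : c ℕ.+ c ≡ c ℕ.+ j ℕ.+ d
  c+c≡ = trans (cong (c ℕ.+_) (ℕ.+-comm d j)) (sym (ℕ.+-assoc c j d))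

  shift-Δ⁻′ : ∀ i k → shift i (Δ⁻ k a) n ≡ shift i a n - shift (i ℕ.+ k) a n
  shift-Δ⁻′ i k = trans (shift-− i a (shift k a) n) (cong (shift i a n -_) (shift-shift i k a n))

  right : shift d (Δ⁻ j (Δ⁻ j a)) n ≡ (shift d a n - shift c a n) - (shift c a n - shift (c ℕ.+ j) a n)
  right = begin
    shift d (Δ⁻ j (Δ⁻ j a)) n                       ≡⟨ shift-− d (Δ⁻ j a) (shift j (Δ⁻ j a)) n ⟩
    shift d (Δ⁻ j a) n - shift d (shift j (Δ⁻ j a)) n ≡⟨ cong (shift d (Δ⁻ j a) n -_) (shift-shift d j (Δ⁻ j a) n) ⟩
    shift d (Δ⁻ j a) n - shift c (Δ⁻ j a) n         ≡⟨ cong₂ _-_ (shift-Δ⁻′ d j) (shift-Δ⁻′ c j) ⟩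
    (shift d a n - shift c a n) - (shift c a n - shift (c ℕ.+ j) a n) ∎

-- The terminating sum S_N and its recurrence in N

partialSum : (ℕ → PowerSeries) → ℕ → PowerSeries
partialSum t zero    n = t zero n
partialSum t (suc k) n = partialSum t k n + t (suc k) n

module _ (T : ℕ → PowerSeries) where

  term : ℕ → ℕ → PowerSeries
  term N k = falling N k (T k)

  partialSum-low : (∀ {k n} → n < k → T k n ≡ 0ℚ) →
                   ∀ {N n} k → k ≤ N → n ≤ N → partialSum (term N) k n ≡ partialSum T k n
  partialSum-low van zero    k≤N n≤N = refl
  partialSum-low van (suc k) k<N n≤N = cong₂ _+_ (partialSum-low van k (ℕ.<⇒≤ k<N) n≤N)
    (falling-low _ (suc k) van k<N n≤N)

  module _ (T-rec : ∀ k → Δ⁻ (suc k) (Δ⁻ (suc k) (T (suc k))) ≗ shift (suc k) (Δ⁺ k (T k))) where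

    -- With u = (1 - q^N) ⋯ (1 - q^{N-k+1}) T_{k+1}, the two terms of index k + 1 are (1 - q^{N+1})
    -- u and (1 - q^{N-k}) u. Apply `Δ⁻²-identity` to u with d = N - k and j = k + 1, so that d + j
    -- = N + 1; the recurrence for T turns its last summand into a multiple of `term N k`.
    term-rec : ∀ {N k} → k ≤ N →
               Δ⁻ (suc N) (term (suc N) (suc k)) ≗
               λ n → Δ⁻ (suc N ℕ.+ suc k) (term N (suc k)) n + shift (suc N) (Δ⁺ k (term N k)) n
    term-rec {N} {k} k≤N n = begin
      Δ⁻ (suc N) (term (suc N) (suc k)) n
        ≡⟨ Δ⁻-cong (suc N) (falling-suc N k (T (suc k))) n ⟩
      Δ⁻ (suc N) (Δ⁻ (suc N) u) n
        ≡⟨ subst (λ m → Δ⁻ m (Δ⁻ m u) n ≡ Δ⁻ (m ℕ.+ suc k) (Δ⁻ d u) n + shift d (Δ⁻ (suc k) (Δ⁻ (suc k) u)) n)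
             d+1+k≡1+N (Δ⁻²-identity d (suc k) u n) ⟩
      Δ⁻ (suc N ℕ.+ suc k) (Δ⁻ d u) n + shift d (Δ⁻ (suc k) (Δ⁻ (suc k) u)) n
        ≡⟨ cong (Δ⁻ (suc N ℕ.+ suc k) (Δ⁻ d u) n +_) (shift-cong d inner n) ⟩
      Δ⁻ (suc N ℕ.+ suc k) (Δ⁻ d u) n + shift d (shift (suc k) (Δ⁺ k (term N k))) n
        ≡⟨ cong (Δ⁻ (suc N ℕ.+ suc k) (Δ⁻ d u) n +_)
             (trans (shift-shift d (suc k) (Δ⁺ k (term N k)) n) (cong (λ m → shift m (Δ⁺ k (term N k)) n) d+1+k≡1+N)) ⟩
      Δ⁻ (suc N ℕ.+ suc k) (Δ⁻ d u) n + shift (suc N) (Δ⁺ k (term N k)) n ∎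
      where
      d = N ∸ k
      u = falling N k (T (suc k))

      d+1+k≡1+N : d ℕ.+ suc k ≡ suc N
      d+1+k≡1+N = trans (ℕ.+-suc d k) (cong suc (ℕ.m∸n+n≡m k≤N))

      inner : Δ⁻ (suc k) (Δ⁻ (suc k) u) ≗ shift (suc k) (Δ⁺ k (term N k))
      inner m = begin
        Δ⁻ (suc k) (Δ⁻ (suc k) u) m
          ≡⟨ falling-commute (λ a → Δ⁻ (suc k) (Δ⁻ (suc k) a)) (Δ⁻-cong (suc k) ∘ Δ⁻-cong (suc k))
               (λ j a p → trans (Δ⁻-cong (suc k) (Δ⁻-comm (suc k) j a) p) (Δ⁻-comm (suc k) j (Δ⁻ (suc k) a) p))
               N k (T (suc k)) m ⟩
        falling N k (Δ⁻ (suc k) (Δ⁻ (suc k) (T (suc k)))) m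
          ≡⟨ falling-cong N k (T-rec k) m ⟩
        falling N k (shift (suc k) (Δ⁺ k (T k))) m
          ≡⟨ falling-commute (λ a → shift (suc k) (Δ⁺ k a)) (shift-cong (suc k) ∘ Δ⁺-cong k)
               (λ j a p → trans (shift-cong (suc k) (Δ⁺-Δ⁻-comm k j a) p) (shift-Δ⁻ (suc k) j (Δ⁺ k a) p))
               N k (T k) m ⟨
        shift (suc k) (Δ⁺ k (term N k)) m ∎

    -- The telescoping cut off at `k`, with q^{N+1} (1 + q^k) `term N k` as the remainder. In the
    -- induction step `term-rec` produces the old remainder, and the rest combines with the new one:
    -- (1 - q^{N+k+2}) + q^{N+1} (1 + q^{k+1}) = 1 + q^{N+1}.
    partialSum-rec : ∀ {N} k → k ≤ suc N → ∀ n →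
      Δ⁻ (suc N) (partialSum (term (suc N)) k) n + shift (suc N) (Δ⁺ k (term N k)) n ≡
      Δ⁺ (suc N) (partialSum (term N) k) n
    partialSum-rec {N} zero _ n = begin
      -- At k = 0 the factor 1 + q^0 of the remainder is 2.
      (x - y) + shift (suc N) (Δ⁺ 0 (T 0)) n  ≡⟨ cong (x - y +_) (shift-+ (suc N) (T 0) (T 0) n) ⟩
      (x - y) + (y + y)                      ≡⟨ solve 2 (λ x y → x :- y :+ (y :+ y) := x :+ y) refl x y ⟩
      x + y                                  ∎
      where
      x = T 0 n
      y = shift (suc N) (T 0) n
    partialSum-rec {N} (suc k) (s≤s k≤N) n = begin
      Δ⁻ (suc N) (partialSum (term (suc N)) (suc k)) n + shift (suc N) (Δ⁺ (suc k) a) n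
        ≡⟨ cong₂ (λ x y → S′ + s′ - x + y) (shift-+ (suc N) (partialSum (term (suc N)) k) (term (suc N) (suc k)) n)
             (trans (shift-+ (suc N) a (shift (suc k) a) n)
                    (cong (shift (suc N) a n +_) (shift-shift (suc N) (suc k) a n))) ⟩
      S′ + s′ - (xS′ + xs′) + (xa + xxa)
        ≡⟨ solve 6 (λ S′ s′ xS′ xs′ xa xxa → S′ :+ s′ :- (xS′ :+ xs′) :+ (xa :+ xxa) :=
                                          S′ :- xS′ :+ (s′ :- xs′) :+ (xa :+ xxa)) refl
             S′ s′ xS′ xs′ xa xxa ⟩
      S′ - xS′ + Δ⁻ (suc N) (term (suc N) (suc k)) n + (xa + xxa)
        ≡⟨ cong (λ z → S′ - xS′ + z + (xa + xxa)) (term-rec k≤N n) ⟩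
      S′ - xS′ + (a n - xxa + r) + (xa + xxa)
        ≡⟨ solve 6 (λ S′ xS′ a xxa r xa → S′ :- xS′ :+ (a :- xxa :+ r) :+ (xa :+ xxa) :=
                                      (S′ :- xS′ :+ r) :+ (a :+ xa)) refl
             S′ xS′ (a n) xxa r xa ⟩
      (Δ⁻ (suc N) (partialSum (term (suc N)) k) n + r) + (a n + xa)
        ≡⟨ cong (_+ (a n + xa)) (partialSum-rec k (ℕ.m≤n⇒m≤1+n k≤N) n) ⟩
      (S + xS) + (a n + xa)
        ≡⟨ solve 4 (λ S xS a xa → S :+ xS :+ (a :+ xa) := S :+ a :+ (xS :+ xa)) refl S xS (a n) xa ⟩
      (S + a n) + (xS + xa)
        ≡⟨ cong (S + a n +_) (shift-+ (suc N) (partialSum (term N) k) a n) ⟨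
      Δ⁺ (suc N) (partialSum (term N) (suc k)) n ∎
      where
      a = term N (suc k)
      S = partialSum (term N) k n
      S′ = partialSum (term (suc N)) k n
      s′ = term (suc N) (suc k) n
      xS = shift (suc N) (partialSum (term N) k) n
      xS′ = shift (suc N) (partialSum (term (suc N)) k) n
      xs′ = shift (suc N) (term (suc N) (suc k)) n
      xa = shift (suc N) a n
      xxa = shift (suc N ℕ.+ suc k) a n
      r = shift (suc N) (Δ⁺ k (term N k)) n

    -- The telescoping is run up to index N + 1, where `term N (suc N)` contains the factor 1 - q^0
    -- = 0; this removes both the remainder and the last summand on the right.
    series-rec : ∀ N → Δ⁻ (suc N) (partialSum (term (suc N)) (suc N)) ≗ Δ⁺ (suc N) (partialSum (term N) N)
    series-rec N n = begin
      Δ⁻ (suc N) (partialSum (term (suc N)) (suc N)) n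
        ≡⟨ ℚ.+-identityʳ _ ⟨
      Δ⁻ (suc N) (partialSum (term (suc N)) (suc N)) n + 0ℚ
        ≡⟨ cong (Δ⁻ (suc N) (partialSum (term (suc N)) (suc N)) n +_)
             (shift-vanish (suc N) {suc n} (λ {m} _ → Δ⁺-vanish m) (ℕ.m≤n+m (suc n) (suc N))) ⟨
      Δ⁻ (suc N) (partialSum (term (suc N)) (suc N)) n + shift (suc N) (Δ⁺ (suc N) (term N (suc N))) n
        ≡⟨ partialSum-rec (suc N) ℕ.≤-refl n ⟩
      Δ⁺ (suc N) (partialSum (term N) (suc N)) n
        ≡⟨ Δ⁺-cong (suc N) {b = partialSum (term N) N} (λ m → trans
             (cong (partialSum (term N) N m +_) (falling-vanish N (T (suc N)) m)) (ℚ.+-identityʳ _)) n ⟩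
      Δ⁺ (suc N) (partialSum (term N) N) n ∎
      where
      Δ⁺-vanish : ∀ m → Δ⁺ (suc N) (term N (suc N)) m ≡ 0ℚ
      Δ⁺-vanish m = trans (cong₂ _+_ (falling-vanish N (T (suc N)) m)
        (shift-vanish (suc N) {suc m} (λ {p} _ → falling-vanish N (T (suc N)) p) (ℕ.m≤n+m (suc m) (suc N)))) refl

    -- Since 1 - q^{N+1} can be cancelled, the recurrence and the initial value determine every
    -- `P N`.
    series-unique : (P : ℕ → PowerSeries) → P 0 ≗ T 0 →
                    (∀ N → Δ⁻ (suc N) (P (suc N)) ≗ Δ⁺ (suc N) (P N)) →
                    ∀ N → P N ≗ partialSum (term N) N
    series-unique P P₀ P-rec zero    = P₀
    series-unique P P₀ P-rec (suc N) = Δ⁻-injective N {P (suc N)} λ n → trans (P-rec N n)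
      (trans (Δ⁺-cong (suc N) (series-unique P P₀ P-rec N) n) (sym (series-rec N n)))

-- Weighted series of classes of partitions

private
  variable
    C C′ Q : Pred (List ℕ) 0ℓ

total : (List ℕ → ℚ) → List (List ℕ) → ℚ
total w xs = foldr _+_ 0ℚ (map w xs)

-- Membership is compared only at sum `n`, so a bound met by every partition of `n` may be added or
-- dropped within one coefficient.
series-cong : (C? : Decidable C) (C′? : Decidable C′) {w w′ : List ℕ → ℚ} → ∀ n →
              (∀ {π} → ∣ π ∣ ≡ n → C π → C′ π) → (∀ {π} → ∣ π ∣ ≡ n → C′ π → C π) →
              (∀ {π} → C π → w π ≡ w′ π) →
              weightedSeries C? w n ≡ weightedSeries C′? w′ n
series-cong C? C′? {w} {w′} n C⇒C′ C′⇒C w≡w′ = begin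
  total w (ofSize C? n)    ≡⟨ cong (foldr _+_ 0ℚ) (map-cong-local
                                (All.map (w≡w′ ∘ proj₁) (All.all-filter (λ π → C? π ×-dec (∣ π ∣ ℕ.≟ n)) (boundedLists n n)))) ⟩
  total w′ (ofSize C? n)   ≡⟨ cong (total w′) (filter-≐ _ _
                                ((λ (c , eq) → C⇒C′ eq c , eq) , (λ (c , eq) → C′⇒C eq c , eq)) (boundedLists n n)) ⟩
  total w′ (ofSize C′? n)  ∎

series-cong-weight : (C? : Decidable C) {w w′ : List ℕ → ℚ} → (∀ {π} → C π → w π ≡ w′ π) →
                     weightedSeries C? w ≗ weightedSeries C? w′
series-cong-weight C? w≡w′ n = series-cong C? C? n (λ _ c → c) (λ _ c → c) w≡w′

series-empty : (C? : Decidable C) (w : List ℕ → ℚ) → ∀ n →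
               (∀ {π} → C π → ∣ π ∣ ≢ n) → weightedSeries C? w n ≡ 0ℚ
series-empty C? w n empty = cong (total w)
  (filter-none (λ π → C? π ×-dec (∣ π ∣ ℕ.≟ n)) (All.universal (λ _ (c , eq) → empty c eq) (boundedLists n n)))

series-split : (C? : Decidable C) (Q? : Decidable Q) (w : List ℕ → ℚ) → ∀ n →
               weightedSeries C? w n ≡
               weightedSeries (C? ∩? Q?) w n + weightedSeries (C? ∩? ∁? Q?) w n
series-split C? Q? w n = total-filter-split (λ π → ∣ π ∣ ℕ.≟ n) (boundedLists n n)
  where
  -- For an abstract S?, because ∣ π ∣ ≟ n unfolds and then escapes the with-abstraction.
  total-filter-split : ∀ {S : Pred (List ℕ) 0ℓ} (S? : Decidable S) xs →
    total w (filter (C? ∩? S?) xs) ≡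
    total w (filter ((C? ∩? Q?) ∩? S?) xs) + total w (filter ((C? ∩? ∁? Q?) ∩? S?) xs)
  total-filter-split S? []       = refl
  total-filter-split S? (π ∷ xs) with ih ← total-filter-split S? xs with C? π | S? π | Q? π
  ... | no _  | _     | _     = ih
  ... | yes _ | no _  | no _  = ih
  ... | yes _ | no _  | yes _ = ih
  ... | yes _ | yes _ | yes _ = trans (cong (w π +_) ih) (sym (ℚ.+-assoc (w π) _ _))
  ... | yes _ | yes _ | no _  = trans (cong (w π +_) ih)
    (solve 3 (λ x y z → x :+ (y :+ z) := y :+ (x :+ z)) refl
       (w π) (total w (filter ((C? ∩? Q?) ∩? S?) xs)) _)

series-linear : (C? : Decidable C) → ∀ c w d w′ n →
                weightedSeries C? (λ π → c * w π + d * w′ π) n ≡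
                c * weightedSeries C? w n + d * weightedSeries C? w′ n
series-linear C? c w d w′ n = go (ofSize C? n)
  where
  go : ∀ xs → total (λ π → c * w π + d * w′ π) xs ≡ c * total w xs + d * total w′ xs
  go []       = solve 2 (λ c d → con 0ℚ := c :* con 0ℚ :+ d :* con 0ℚ) refl c d
  go (π ∷ xs) = trans (cong (c * w π + d * w′ π +_) (go xs))
    (solve 6 (λ c d x y z t → c :* x :+ d :* y :+ (c :* z :+ d :* t) := c :* (x :+ z) :+ d :* (y :+ t))
       refl c d (w π) (w′ π) (total w xs) (total w′ xs))

total-image : ∀ {xs ys} (f : List ℕ → List ℕ) (w : List ℕ → ℚ) → map f xs ↭ ys → total w ys ≡ total (w ∘ f) xs
total-image {xs} {ys} f w p = begin
  total w ys          ≡⟨ ↭ₛ.foldr-commMonoid (setoid ℚ) ℚ.+-0-isCommutativeMonoid (↭⇒↭ₛ (↭.map⁺ w p)) ⟨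
  total w (map f xs)  ≡⟨ cong (foldr _+_ 0ℚ) (map-∘ xs) ⟨
  total (w ∘ f) xs    ∎

-- The map `f` is a bijection from `C′` onto `C` that raises the size by `j`, which is
-- multiplication by q^j. For n ≥ j the image of one enumeration and the other enumeration are free
-- of duplicates and have the same members, so they are permutations of each other; for n < j
-- nothing in `C` is small enough.
series-image : (C? : Decidable C) (C′? : Decidable C′) → C ⊆ 𝒰 → C′ ⊆ 𝒰 →
               ∀ j (f : List ℕ → List ℕ) → Injective _≡_ _≡_ f →
               (∀ {ρ} → C′ ρ → C (f ρ)) → (∀ {π} → C π → ∃ λ ρ → C′ ρ × π ≡ f ρ) →
               (∀ {ρ} → C′ ρ → ∣ f ρ ∣ ≡ j ℕ.+ ∣ ρ ∣) →
               ∀ w → weightedSeries C? w ≗ shift j (weightedSeries C′? (w ∘ f))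
series-image {C} {C′} C? C′? C⊆𝒰 C′⊆𝒰 j f f-inj f-C C-f size w n with j ℕ.≤? n
... | no j≰n = trans
  (series-empty C? w n λ c ∣π∣≡n → case C-f c of λ where
    (ρ , c′ , refl) → j≰n (subst (j ≤_) (trans (sym (size c′)) ∣π∣≡n) (ℕ.m≤m+n j ∣ ρ ∣)))
  (sym (shift-vanish j {0} (λ ()) (subst (n <_) (sym (ℕ.+-identityʳ j)) (ℕ.≰⇒> j≰n))))
... | yes j≤n = subst (λ n → weightedSeries C? w n ≡ shift j a n) (ℕ.m+[n∸m]≡n j≤n)
                  (trans (total-image f w (∼bag⇒↭ (unique∧set⇒bag
                           (Unique.map⁺ f-inj (ofSize-unique C′? m)) (ofSize-unique C? (j ℕ.+ m))
                           (mk⇔ image⊆ ⊆image))))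
                         (sym (shift-+-cancel j a m)))
  where
  a = weightedSeries C′? (w ∘ f)
  m = n ∸ j
  open Equivalence

  image⊆ : ∀ {π} → π ∈ map f (ofSize C′? m) → π ∈ ofSize C? (j ℕ.+ m)
  image⊆ π∈ with ρ , ρ∈ , refl ← ∈-map⁻ f π∈
        with c′ , eq ← ∈-ofSize C′? C′⊆𝒰 m .to ρ∈ =
    ∈-ofSize C? C⊆𝒰 (j ℕ.+ m) .from (f-C c′ , trans (size c′) (cong (j ℕ.+_) eq))

  ⊆image : ∀ {π} → π ∈ ofSize C? (j ℕ.+ m) → π ∈ map f (ofSize C′? m)
  ⊆image π∈ with c , eq ← ∈-ofSize C? C⊆𝒰 (j ℕ.+ m) .to π∈
          with ρ , c′ , refl ← C-f c =
    ∈-map⁺ f (∈-ofSize C′? C′⊆𝒰 m .from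
      (c′ , ℕ.+-cancelˡ-≡ j ∣ ρ ∣ m (trans (sym (size c′)) eq)))

-- The comparison takes place among unnormalised fractions, where a sum over denominator 1 can be
-- read off without reducing by a gcd.
fromℕ-+ : ∀ m n → fromℕ (m ℕ.+ n) ≡ fromℕ m + fromℕ n
fromℕ-+ m n = ℚ.toℚᵘ-injective (ℚᵘ.≃-trans (toℚᵘ-fromℕ (m ℕ.+ n)) (ℚᵘ.≃-trans
  (ℚᵘ.≃-reflexive (cong (λ z → mkℚᵘ z 0) (sym (cong₂ ℤ._+_ (ℤ.*-identityʳ (ℤ.+ m)) (ℤ.*-identityʳ (ℤ.+ n))))))
  (ℚᵘ.≃-sym (ℚᵘ.≃-trans (ℚ.toℚᵘ-homo-+ (fromℕ m) (fromℕ n)) (ℚᵘ.+-cong (toℚᵘ-fromℕ m) (toℚᵘ-fromℕ n))))))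
  where
  toℚᵘ-fromℕ : ∀ k → toℚᵘ (fromℕ k) ℚᵘ.≃ mkℚᵘ (ℤ.+ k) 0
  toℚᵘ-fromℕ k = ℚ.toℚᵘ-fromℚᵘ (mkℚᵘ (ℤ.+ k) 0)

-- All partitions

𝒰≤ : ℕ → Pred (List ℕ) 0ℓ
𝒰≤ N = 𝒰 ∩ All (_≤ N)

𝒰≤? : ∀ N → Decidable (𝒰≤ N)
𝒰≤? N = 𝒰? ∩? All.all? (ℕ._≤? N)

-- The first part bounds all others, so if some part exceeds `M` the first one does, and it must
-- then equal `suc M`.
largest-part : ∀ {M π} → 𝒰≤ (suc M) π → ¬ All (_≤ M) π → ∃ λ ρ → 𝒰≤ (suc M) ρ × π ≡ suc M ∷ ρ
largest-part {π = []} _ ¬all = contradiction [] ¬all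
largest-part {M} {x ∷ ρ} ((_ ∷ pos , dec) , x≤1+M ∷ ρ≤1+M) ¬all with x ℕ.≤? M
... | no x≰M  = ρ , ((pos , Linked.tail dec) , ρ≤1+M) , cong (_∷ ρ) (ℕ.≤-antisym x≤1+M (ℕ.≰⇒> x≰M))
... | yes x≤M with x≥ρ ∷ _ ← Linked⇒AllPairs (λ p q → ℕ.≤-trans q p) dec =
  contradiction (x≤M ∷ All.map (λ y≤x → ℕ.≤-trans y≤x x≤M) x≥ρ) ¬all

∷-𝒰≤ : ∀ {M ρ} → 𝒰≤ (suc M) ρ → 𝒰≤ (suc M) (suc M ∷ ρ)
∷-𝒰≤ ((pos , dec) , ≤1+M) = (s≤s z≤n ∷ pos , cons dec ≤1+M) , ℕ.≤-refl ∷ ≤1+M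
  where
  cons : ∀ {x ρ} → Linked.Linked _≥_ ρ → All (_≤ x) ρ → Linked.Linked _≥_ (x ∷ ρ)
  cons Linked.[]        _         = Linked.[-]
  cons dec@Linked.[-]   (y≤x ∷ _) = y≤x Linked.∷ dec
  cons dec@(_ Linked.∷ _) (y≤x ∷ _) = y≤x Linked.∷ dec

-- The added part exceeds all others, so it is a new value and doubles the weight. The doubling is
-- written as a combination with coefficients `1ℚ` to fit `series-linear`.
ω₁′-new : ∀ {M π} → All (_≤ M) π → ω₁′ (suc M ∷ π) ≡ 1ℚ * ω₁′ π + 1ℚ * ω₁′ π
ω₁′-new {M} {π} π≤M = begin
  fromℕ (2 ^ ν-d (suc M ∷ π))
    ≡⟨ cong (λ ρ → fromℕ (2 ^ suc (length ρ)))
         (filter-all (¬? ∘ (suc M ℕ.≟_)) (All.deduplicate⁺ ℕ._≟_ (All.map (ℕ.>⇒≢ ∘ s≤s) π≤M))) ⟩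
  fromℕ (2 ℕ.* 2 ^ ν-d π)
    ≡⟨ cong (λ m → fromℕ (2 ^ ν-d π ℕ.+ m)) (ℕ.+-identityʳ (2 ^ ν-d π)) ⟩
  fromℕ (2 ^ ν-d π ℕ.+ 2 ^ ν-d π)
    ≡⟨ fromℕ-+ (2 ^ ν-d π) (2 ^ ν-d π) ⟩
  ω₁′ π + ω₁′ π
    ≡⟨ cong₂ _+_ (ℚ.*-identityˡ (ω₁′ π)) (ℚ.*-identityˡ (ω₁′ π)) ⟨
  1ℚ * ω₁′ π + 1ℚ * ω₁′ π ∎

ω₁′-repeat : ∀ x π → ω₁′ (x ∷ x ∷ π) ≡ ω₁′ (x ∷ π)
ω₁′-repeat x π = cong (λ ρ → fromℕ (2 ^ suc (length ρ))) (begin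
  filter ≢x? (x ∷ filter ≢x? (deduplicate ℕ._≟_ π))  ≡⟨ filter-reject ≢x? (λ x≢x → x≢x refl) ⟩
  filter ≢x? (filter ≢x? (deduplicate ℕ._≟_ π))      ≡⟨ filter-idem ≢x? (deduplicate ℕ._≟_ π) ⟩
  filter ≢x? (deduplicate ℕ._≟_ π)                   ∎)
  where ≢x? = ¬? ∘ (x ℕ.≟_)

𝒰-series : ℕ → PowerSeries
𝒰-series N = weightedSeries (𝒰≤? N) ω₁′

-- Let N = M + 1, let P be the series for parts at most M and H that of the partitions in which N
-- occurs. Removing one copy of N halves the weight if no other copy is left and preserves it
-- otherwise, so H = q^N (2 P + H). Hence (1 - q^N) (P + H) = (1 + q^N) P.
𝒰-series-rec : ∀ M → Δ⁻ (suc M) (𝒰-series (suc M)) ≗ Δ⁺ (suc M) (𝒰-series M)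
𝒰-series-rec M n = begin
  𝒰-series N n - shift N (𝒰-series N) n
    ≡⟨ cong₂ _-_ (split n) (trans (shift-cong N split n) (shift-+ N P H n)) ⟩
  (P n + H n) - (shift N P n + shift N H n)
    ≡⟨ cong (λ h → P n + h - (shift N P n + shift N H n)) (H-rec n) ⟩
  (P n + (shift N P n + shift N P n + shift N H n)) - (shift N P n + shift N H n)
    ≡⟨ solve 3 (λ p xp xh → p :+ (xp :+ xp :+ xh) :- (xp :+ xh) := p :+ xp) refl
         (P n) (shift N P n) (shift N H n) ⟩
  P n + shift N P n ∎
  where
  N = suc M
  ≤M? = All.all? (ℕ._≤? M)
  P = 𝒰-series M
  H = weightedSeries (𝒰≤? N ∩? ∁? ≤M?) ω₁′

  below : ∀ {w w′} → (∀ {π} → All (_≤ M) π → w π ≡ w′ π) →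
          weightedSeries (𝒰≤? N ∩? ≤M?) w ≗ weightedSeries (𝒰≤? M) w′
  below eq n = series-cong (𝒰≤? N ∩? ≤M?) (𝒰≤? M) n
    (λ _ ((u , _) , ≤M) → u , ≤M) (λ _ (u , ≤M) → (u , All.map ℕ.m≤n⇒m≤1+n ≤M) , ≤M) (eq ∘ proj₂)

  split : 𝒰-series N ≗ λ n → P n + H n
  split n = trans (series-split (𝒰≤? N) ≤M? ω₁′ n) (cong (_+ H n) (below (λ _ → refl) n))

  H-rec : H ≗ λ n → shift N P n + shift N P n + shift N H n
  H-rec n = begin
    H n
      ≡⟨ series-image (𝒰≤? N ∩? ∁? ≤M?) (𝒰≤? N) (proj₁ ∘ proj₁) proj₁ N (N ∷_) ∷-injectiveʳ
           (λ u → ∷-𝒰≤ u , λ { (N≤M ∷ _) → ℕ.1+n≰n N≤M })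
           (λ (u , ¬≤M) → largest-part u ¬≤M) (λ _ → refl) ω₁′ n ⟩
    shift N (weightedSeries (𝒰≤? N) (ω₁′ ∘ (N ∷_))) n
      ≡⟨ shift-cong N (λ m → trans (series-split (𝒰≤? N) ≤M? (ω₁′ ∘ (N ∷_)) m)
           (cong₂ _+_
             (trans (below ω₁′-new m) (trans (series-linear (𝒰≤? M) 1ℚ ω₁′ 1ℚ ω₁′ m)
               (cong₂ _+_ (ℚ.*-identityˡ (P m)) (ℚ.*-identityˡ (P m)))))
             (series-cong-weight (𝒰≤? N ∩? ∁? ≤M?)
               (λ (u , ¬≤M) → case largest-part u ¬≤M of λ { (ρ , _ , refl) → ω₁′-repeat N ρ }) m))) n ⟩
    shift N (λ m → (P m + P m) + H m) n
      ≡⟨ trans (shift-+ N (λ m → P m + P m) H n) (cong (_+ shift N H n) (shift-+ N P P n)) ⟩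
    shift N P n + shift N P n + shift N H n ∎

-- Partitions into distinct parts

-- An equivalent form of `𝒟` whose order condition on all pairs carries over directly along
-- `map suc` and `_∷ʳ 0`.
Strict : Pred (List ℕ) 0ℓ
Strict π = All (0 <_) π × AllPairs _>_ π

𝒟⇒Strict : 𝒟 ⊆ Strict
𝒟⇒Strict ((pos , dec) , uniq) =
  pos , AllPairs.zipWith (λ (x≥y , x≢y) → ℕ.≤∧≢⇒< x≥y (x≢y ∘ sym))
          (Linked⇒AllPairs (λ p q → ℕ.≤-trans q p) dec , uniq)

Strict⇒𝒟 : Strict ⊆ 𝒟
Strict⇒𝒟 (pos , dec) = (pos , AllPairs⇒Linked (AllPairs.map ℕ.<⇒≤ dec)) , AllPairs.map ℕ.>⇒≢ dec

map-suc-view : ∀ {π} → Strict π → ∃ λ ρ → AllPairs _>_ ρ × π ≡ map suc ρ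
map-suc-view {π} (pos , dec) =
  map pred π , AllPairs.map ℕ.s<s⁻¹ (AllPairs.map⁻ (subst (AllPairs _>_) π≡ dec)) , π≡
  where
  π≡ : π ≡ map suc (map pred π)
  π≡ = sym (trans (sym (map-∘ π)) (map-id-local (All.map (λ { (s≤s z≤n) → refl }) pos)))

Strict-map-suc : ∀ {ρ} → AllPairs _>_ ρ → Strict (map suc ρ)
Strict-map-suc {ρ} dec = All.map⁺ (All.universal (λ _ → s≤s z≤n) ρ) , AllPairs.map⁺ (AllPairs.map s≤s dec)

-- Nothing lies below 0, so in a strictly decreasing list only the last entry can be 0.
trailing-zero : ∀ {σ} → AllPairs _>_ σ → ¬ All (0 <_) σ → ∃ λ ρ → Strict ρ × σ ≡ ρ ∷ʳ 0
trailing-zero {[]} _ ¬pos = contradiction [] ¬pos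
trailing-zero {x ∷ σ} (x> ∷ dec) ¬pos with All.all? (0 ℕ.<?_) σ
trailing-zero {zero ∷ []}     _          _    | yes _ = [] , ([] , []) , refl
trailing-zero {zero ∷ _ ∷ _} ((() ∷ _) ∷ _) _ | yes _
trailing-zero {suc x ∷ σ} _ ¬pos | yes pos = contradiction (s≤s z≤n ∷ pos) ¬pos
... | no ¬pos′ with ρ , (pos , dec′) , refl ← trailing-zero dec ¬pos′
               with x>ρ , (x>0 ∷ []) ← All.++⁻ ρ x> = x ∷ ρ , (x>0 ∷ pos , x>ρ ∷ dec′) , refl

sum-map-suc : ∀ π → ∣ map suc π ∣ ≡ length π ℕ.+ ∣ π ∣
sum-map-suc []      = refl
sum-map-suc (x ∷ π) = cong suc (begin
  x ℕ.+ ∣ map suc π ∣             ≡⟨ cong (x ℕ.+_) (sum-map-suc π) ⟩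
  x ℕ.+ (length π ℕ.+ ∣ π ∣)      ≡⟨ ℕ.+-assoc x (length π) ∣ π ∣ ⟨
  x ℕ.+ length π ℕ.+ ∣ π ∣        ≡⟨ cong (ℕ._+ ∣ π ∣) (ℕ.+-comm x (length π)) ⟩
  length π ℕ.+ x ℕ.+ ∣ π ∣        ≡⟨ ℕ.+-assoc (length π) x ∣ π ∣ ⟩
  length π ℕ.+ (x ℕ.+ ∣ π ∣)      ∎)

length-∷ʳ : ∀ (π : List ℕ) x → length (π ∷ʳ x) ≡ suc (length π)
length-∷ʳ π x = trans (length-++ π) (ℕ.+-comm (length π) 1)

length≤sum : ∀ {π} → All (0 <_) π → length π ≤ ∣ π ∣
length≤sum []          = z≤n
length≤sum (x>0 ∷ pos) = ℕ.+-mono-≤ x>0 (length≤sum pos)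

-- Transformation rules for the weight

-- ω̃₁ with the convention λ_{ν(π)+1} = s in place of -1/2.
next : ℚ → List ℕ → ℚ
next s []      = s
next s (l ∷ _) = fromℕ l

weight : ℚ → List ℕ → ℚ
weight s []      = 1ℚ
weight s (l ∷ π) = (fromℕ 2 * fromℕ l - fromℕ 2 * next s π - 1ℚ) * weight s π

ω̃₁≗weight : ω̃₁ ≗ weight -½
ω̃₁≗weight []          = refl
ω̃₁≗weight (l ∷ [])    = refl
ω̃₁≗weight (l ∷ m ∷ π) = cong ((fromℕ 2 * fromℕ l - fromℕ 2 * fromℕ m - 1ℚ) *_) (ω̃₁≗weight (m ∷ π))

-- Only the last factor involves `s`, and it is affine in `s`; the formula interpolates between the
-- values at 0 and -1/2. The coefficients add up to 1, which covers the empty partition.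
weight-affine : ∀ s π → weight s π ≡ (1ℚ + fromℕ 2 * s) * weight 0ℚ π + (0ℚ - fromℕ 2 * s) * weight -½ π
weight-affine s [] = solve 1 (λ s →
  con 1ℚ := (con 1ℚ :+ con (fromℕ 2) :* s) :* con 1ℚ :+ (con 0ℚ :- con (fromℕ 2) :* s) :* con 1ℚ) refl s
weight-affine s (l ∷ []) = solve 2 (λ s l →
  (con (fromℕ 2) :* l :- con (fromℕ 2) :* s :- con 1ℚ) :* con 1ℚ :=
  (con 1ℚ :+ con (fromℕ 2) :* s) :* ((con (fromℕ 2) :* l :- con (fromℕ 2) :* con 0ℚ :- con 1ℚ) :* con 1ℚ) :+
  (con 0ℚ :- con (fromℕ 2) :* s) :* ((con (fromℕ 2) :* l :- con (fromℕ 2) :* con -½ :- con 1ℚ) :* con 1ℚ))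
  refl s (fromℕ l)
weight-affine s (l ∷ m ∷ π) = trans (cong (g *_) (weight-affine s (m ∷ π)))
  (solve 5 (λ g c d v t → g :* (c :* v :+ d :* t) := c :* (g :* v) :+ d :* (g :* t)) refl
     g (1ℚ + fromℕ 2 * s) (0ℚ - fromℕ 2 * s) (weight 0ℚ (m ∷ π)) (weight -½ (m ∷ π)))
  where g = fromℕ 2 * fromℕ l - fromℕ 2 * fromℕ m - 1ℚ

-- Each factor depends only on the difference of two neighbours, so lowering every part by 1 amounts
-- to lowering the value past the last part as well.
weight-map-suc : ∀ s π → weight s (map suc π) ≡ weight (s - 1ℚ) π
weight-map-suc s []      = refl
weight-map-suc s (l ∷ π) = cong₂ _*_ (begin
  fromℕ 2 * fromℕ (suc l) - fromℕ 2 * next s (map suc π) - 1ℚ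
    ≡⟨ cong₂ (λ x y → fromℕ 2 * x - fromℕ 2 * y - 1ℚ) (fromℕ-+ 1 l) (next-map-suc π) ⟩
  fromℕ 2 * (1ℚ + fromℕ l) - fromℕ 2 * (1ℚ + next (s - 1ℚ) π) - 1ℚ
    ≡⟨ solve 2 (λ x y → con (fromℕ 2) :* (con 1ℚ :+ x) :- con (fromℕ 2) :* (con 1ℚ :+ y) :- con 1ℚ :=
                        con (fromℕ 2) :* x :- con (fromℕ 2) :* y :- con 1ℚ) refl (fromℕ l) (next (s - 1ℚ) π) ⟩
  fromℕ 2 * fromℕ l - fromℕ 2 * next (s - 1ℚ) π - 1ℚ ∎)
  (weight-map-suc s π)
  where
  next-map-suc : ∀ π → next s (map suc π) ≡ 1ℚ + next (s - 1ℚ) π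
  next-map-suc []      = solve 1 (λ s → s := con 1ℚ :+ (s :- con 1ℚ)) refl s
  next-map-suc (m ∷ _) = fromℕ-+ 1 m

-- The appended part contributes the factor 2·0 - 2s - 1 and takes over as the value that follows
-- the last part of `π`.
weight-∷ʳ-0 : ∀ s π → weight s (π ∷ʳ 0) ≡ (0ℚ - fromℕ 2 * s - 1ℚ) * weight 0ℚ π
weight-∷ʳ-0 s []          = refl
weight-∷ʳ-0 s (l ∷ [])    = solve 2 (λ x y → x :* (y :* con 1ℚ) := y :* (x :* con 1ℚ)) refl
  (fromℕ 2 * fromℕ l - fromℕ 2 * 0ℚ - 1ℚ) (0ℚ - fromℕ 2 * s - 1ℚ)
weight-∷ʳ-0 s (l ∷ m ∷ π) = trans (cong (g *_) (weight-∷ʳ-0 s (m ∷ π)))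
  (solve 3 (λ x y z → x :* (y :* z) := y :* (x :* z)) refl g (0ℚ - fromℕ 2 * s - 1ℚ) (weight 0ℚ (m ∷ π)))
  where g = fromℕ 2 * fromℕ l - fromℕ 2 * fromℕ m - 1ℚ

-- Recurrences for partitions into k distinct parts

𝒟# : ℕ → Pred (List ℕ) 0ℓ
𝒟# k = 𝒟 ∩ λ π → length π ≡ k

𝒟#? : ∀ k → Decidable (𝒟# k)
𝒟#? k = 𝒟? ∩? λ π → length π ℕ.≟ k

𝒟-series : ℚ → ℕ → PowerSeries
𝒟-series s k = weightedSeries (𝒟#? k) (weight s)

-- Subtracting 1 from every part leaves a partition with as many parts, or, if
-- the smallest part was 1, one part fewer and the smallest part measured against 0.
𝒟-series-rec : ∀ s k → 𝒟-series s (suc k) ≗ λ n →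
  shift (suc k) (𝒟-series (s - 1ℚ) (suc k)) n +
  (0ℚ - fromℕ 2 * (s - 1ℚ) - 1ℚ) * shift (suc k) (𝒟-series 0ℚ k) n
𝒟-series-rec s k n = begin
  𝒟-series s (suc k) n
    ≡⟨ series-split (𝒟#? (suc k)) >1? (weight s) n ⟩
  weightedSeries (𝒟#? (suc k) ∩? >1?) (weight s) n + weightedSeries (𝒟#? (suc k) ∩? ∁? >1?) (weight s) n
    ≡⟨ cong₂ _+_ (large n) (small n) ⟩
  shift (suc k) (weightedSeries (𝒟#? (suc k)) (weight s ∘ map suc)) n
    + shift (suc k) (weightedSeries (𝒟#? k) (weight s ∘ map suc ∘ (_∷ʳ 0))) n
    ≡⟨ cong₂ _+_ (shift-cong (suc k) large-weight n) (small-weight n) ⟩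
  shift (suc k) (𝒟-series (s - 1ℚ) (suc k)) n + c * shift (suc k) (𝒟-series 0ℚ k) n ∎
  where
  >1? = All.all? (1 ℕ.<?_)
  c = 0ℚ - fromℕ 2 * (s - 1ℚ) - 1ℚ

  large : weightedSeries (𝒟#? (suc k) ∩? >1?) (weight s) ≗
          shift (suc k) (weightedSeries (𝒟#? (suc k)) (weight s ∘ map suc))
  large = series-image (𝒟#? (suc k) ∩? >1?) (𝒟#? (suc k)) (proj₁ ∘ proj₁ ∘ proj₁) (proj₁ ∘ proj₁)
    (suc k) (map suc) (map-injective ℕ.suc-injective)
    (λ {ρ} (d , len) → let pos , dec = 𝒟⇒Strict d in
      (Strict⇒𝒟 (Strict-map-suc dec) , trans (length-map suc ρ) len) , All.map⁺ (All.map s≤s pos))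
    (λ ((d , len) , >1) → case map-suc-view (𝒟⇒Strict d) of λ where
      (ρ , dec , refl) → ρ , (Strict⇒𝒟 (All.map ℕ.s<s⁻¹ (All.map⁻ >1) , dec)
                          , trans (sym (length-map suc ρ)) len) , refl)
    (λ {ρ} (_ , len) → trans (sum-map-suc ρ) (cong (ℕ._+ ∣ ρ ∣) len))
    (weight s)

  small : weightedSeries (𝒟#? (suc k) ∩? ∁? >1?) (weight s) ≗
          shift (suc k) (weightedSeries (𝒟#? k) (weight s ∘ map suc ∘ (_∷ʳ 0)))
  small = series-image (𝒟#? (suc k) ∩? ∁? >1?) (𝒟#? k) (proj₁ ∘ proj₁ ∘ proj₁) (proj₁ ∘ proj₁)
    (suc k) (map suc ∘ (_∷ʳ 0)) (λ {π} {ρ} eq → ∷ʳ-injectiveˡ π ρ (map-injective ℕ.suc-injective eq))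
    (λ {ρ} (d , len) → let pos , dec = 𝒟⇒Strict d in
      (Strict⇒𝒟 (Strict-map-suc (AllPairs.++⁺ dec ([] ∷ []) (All.map (_∷ []) pos)))
      , trans (length-map suc (ρ ∷ʳ 0)) (trans (length-∷ʳ ρ 0) (cong suc len)))
      , λ >1 → case All.++⁻ʳ ρ (All.map⁻ >1) of λ { (s≤s () ∷ _) })
    (λ ((d , len) , ≯1) → case map-suc-view (𝒟⇒Strict d) of λ where
      (σ , dec , refl) → case trailing-zero dec (≯1 ∘ All.map⁺ ∘ All.map s≤s) of λ where
        (ρ , strict , refl) → ρ , (Strict⇒𝒟 strict , ℕ.suc-injective
          (trans (sym (length-∷ʳ ρ 0)) (trans (sym (length-map suc (ρ ∷ʳ 0))) len))) , refl)
    -- The appended 0 counts towards the length, which gives the shift by k + 1, but adds nothing to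
    -- the sum.
    (λ {ρ} (_ , len) → trans (sum-map-suc (ρ ∷ʳ 0)) (cong₂ ℕ._+_
      (trans (length-∷ʳ ρ 0) (cong suc len)) (trans (sum-++ ρ (0 ∷ [])) (ℕ.+-identityʳ ∣ ρ ∣))))
    (weight s)

  large-weight : weightedSeries (𝒟#? (suc k)) (weight s ∘ map suc) ≗ 𝒟-series (s - 1ℚ) (suc k)
  large-weight = series-cong-weight (𝒟#? (suc k)) λ {π} _ → weight-map-suc s π

  small-weight : shift (suc k) (weightedSeries (𝒟#? k) (weight s ∘ map suc ∘ (_∷ʳ 0))) ≗
                 λ m → c * shift (suc k) (𝒟-series 0ℚ k) m
  small-weight m = trans
    (shift-cong (suc k) (λ i → trans
      (series-cong-weight (𝒟#? k) (λ {π} _ → trans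
        (weight-map-suc s (π ∷ʳ 0)) (trans (weight-∷ʳ-0 (s - 1ℚ) π)
          -- A zero summand brings the multiple of a single series into the two-term form of
          -- `series-linear`.
          (solve 2 (λ c v → c :* v := c :* v :+ con 0ℚ :* v) refl c (weight 0ℚ π)))) i)
      (series-linear (𝒟#? k) c (weight 0ℚ) 0ℚ (weight 0ℚ) i)) m)
    (trans (shift-linear (suc k) c (𝒟-series 0ℚ k) 0ℚ (𝒟-series 0ℚ k) m)
      (solve 2 (λ c v → c :* v :+ con 0ℚ :* v := c :* v) refl c (shift (suc k) (𝒟-series 0ℚ k) m)))

𝒟-series-affine : ∀ s k → 𝒟-series s k ≗ λ n →
  (1ℚ + fromℕ 2 * s) * 𝒟-series 0ℚ k n + (0ℚ - fromℕ 2 * s) * 𝒟-series -½ k n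
𝒟-series-affine s k n = trans
  (series-cong-weight (𝒟#? k) (λ {π} _ → weight-affine s π) n)
  (series-linear (𝒟#? k) (1ℚ + fromℕ 2 * s) (weight 0ℚ) (0ℚ - fromℕ 2 * s) (weight -½) n)

T V : ℕ → PowerSeries
T = 𝒟-series -½
V = 𝒟-series 0ℚ

-- Iterating `𝒟-series-rec` would lower `s` without end. Interpolating at `s - 1ℚ` expresses
-- everything by T and V, so the recurrences for s = -1/2 and s = 0 form a closed system.
𝒟-series-rec′ : ∀ s k → 𝒟-series s (suc k) ≗ λ n →
  (1ℚ + fromℕ 2 * (s - 1ℚ)) * shift (suc k) (V (suc k)) n +
  (0ℚ - fromℕ 2 * (s - 1ℚ)) * shift (suc k) (T (suc k)) n +
  (0ℚ - fromℕ 2 * (s - 1ℚ) - 1ℚ) * shift (suc k) (V k) n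
𝒟-series-rec′ s k n = trans (𝒟-series-rec s k n)
  (cong (_+ (0ℚ - fromℕ 2 * (s - 1ℚ) - 1ℚ) * shift (suc k) (V k) n) (trans
    (shift-cong (suc k) (𝒟-series-affine (s - 1ℚ) (suc k)) n)
    (shift-linear (suc k) (1ℚ + fromℕ 2 * (s - 1ℚ)) (V (suc k)) (0ℚ - fromℕ 2 * (s - 1ℚ)) (T (suc k)) n)))

T₀≗V₀ : T 0 ≗ V 0
T₀≗V₀ = series-cong-weight (𝒟#? 0) λ { {[]} _ → refl ; {_ ∷ _} (_ , ()) }

-- For positive index, subtracting the recurrence for T from twice the one for V cancels all V on
-- the right and leaves one shifted copy of T. At index 0 both series count only the empty
-- partition, and 1 + q^0 = 2.
Δ⁺-T : ∀ k → Δ⁺ k (T k) ≗ λ n → 1ℚ * V k n + 1ℚ * V k n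
Δ⁺-T zero    n = trans (cong₂ _+_ (T₀≗V₀ n) (T₀≗V₀ n))
  (sym (cong₂ _+_ (ℚ.*-identityˡ (V 0 n)) (ℚ.*-identityˡ (V 0 n))))
Δ⁺-T (suc k) n = begin
  T (suc k) n + xt
    ≡⟨ cong (_+ xt) (𝒟-series-rec′ -½ k n) ⟩
  _ ≡⟨ solve 3 (λ xv xt xv′ →
         (con 1ℚ :+ con (fromℕ 2) :* (con -½ :- con 1ℚ)) :* xv :+
         (con 0ℚ :- con (fromℕ 2) :* (con -½ :- con 1ℚ)) :* xt :+
         (con 0ℚ :- con (fromℕ 2) :* (con -½ :- con 1ℚ) :- con 1ℚ) :* xv′ :+ xt :=
         con 1ℚ :* v xv xt xv′ :+ con 1ℚ :* v xv xt xv′) refl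
         (shift (suc k) (V (suc k)) n) xt (shift (suc k) (V k) n) ⟩
  _ ≡⟨ cong₂ (λ x y → 1ℚ * x + 1ℚ * y) (𝒟-series-rec′ 0ℚ k n) (𝒟-series-rec′ 0ℚ k n) ⟨
  1ℚ * V (suc k) n + 1ℚ * V (suc k) n ∎
  where
  xt = shift (suc k) (T (suc k)) n
  v = λ xv xt xv′ → (con 1ℚ :+ con (fromℕ 2) :* (con 0ℚ :- con 1ℚ)) :* xv :+
                    (con 0ℚ :- con (fromℕ 2) :* (con 0ℚ :- con 1ℚ)) :* xt :+
                    (con 0ℚ :- con (fromℕ 2) :* (con 0ℚ :- con 1ℚ) :- con 1ℚ) :* xv′

shift-Δ⁺-T : ∀ j k → shift j (Δ⁺ k (T k)) ≗ λ n → 1ℚ * shift j (V k) n + 1ℚ * shift j (V k) n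
shift-Δ⁺-T j k n = trans (shift-cong j (Δ⁺-T k) n) (shift-linear j 1ℚ (V k) 1ℚ (V k) n)

-- Put x = q^{k+1}. Substituting T_{k+1} = x (3 T_{k+1} - 2 V_{k+1} + 2 V_k) once into (1 - x)²
-- T_{k+1} gives x ((1 + x) T_{k+1} - 2 V_{k+1}) + 2 x V_k. By `Δ⁺-T` at k + 1 the bracket vanishes,
-- and at k it rewrites 2 V_k as (1 + q^k) T_k.
T-rec : ∀ k → Δ⁻ (suc k) (Δ⁻ (suc k) (T (suc k))) ≗ shift (suc k) (Δ⁺ k (T k))
T-rec k n = begin
  Δ⁻ j (Δ⁻ j t) n
    ≡⟨ cong (Δ⁻ j t n -_) (shift-− j t (shift j t) n) ⟩
  t n - xt - (xt - xxt)
    ≡⟨ cong (λ y → y - xt - (xt - xxt)) (𝒟-series-rec′ -½ k n) ⟩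
  _ ≡⟨ solve 4 (λ xv xt xv′ xxt →
         ((con 1ℚ :+ con (fromℕ 2) :* (con -½ :- con 1ℚ)) :* xv :+
          (con 0ℚ :- con (fromℕ 2) :* (con -½ :- con 1ℚ)) :* xt :+
          (con 0ℚ :- con (fromℕ 2) :* (con -½ :- con 1ℚ) :- con 1ℚ) :* xv′) :- xt :- (xt :- xxt) :=
         (xt :+ xxt) :- (con 1ℚ :* xv :+ con 1ℚ :* xv) :+ (con 1ℚ :* xv′ :+ con 1ℚ :* xv′)) refl
         xv xt (shift j (V k) n) xxt ⟩
  (xt + xxt) - (1ℚ * xv + 1ℚ * xv) + xΔ⁺t′
    ≡⟨ cong (λ y → y - (1ℚ * xv + 1ℚ * xv) + xΔ⁺t′) (trans (sym (shift-+ j t (shift j t) n)) (shift-Δ⁺-T j j n)) ⟩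
  (1ℚ * xv + 1ℚ * xv) - (1ℚ * xv + 1ℚ * xv) + xΔ⁺t′
    ≡⟨ solve 2 (λ a b → a :- a :+ b := b) refl (1ℚ * xv + 1ℚ * xv) xΔ⁺t′ ⟩
  xΔ⁺t′
    ≡⟨ shift-Δ⁺-T j k n ⟨
  shift j (Δ⁺ k (T k)) n ∎
  where
  j = suc k
  t = T j
  xt = shift j t n
  xxt = shift j (shift j t) n
  xv = shift j (V j) n
  xΔ⁺t′ = 1ℚ * shift j (V k) n + 1ℚ * shift j (V k) n

T-low : ∀ {k n} → n < k → T k n ≡ 0ℚ
T-low {k} {n} n<k = series-empty (𝒟#? k) (weight -½) n λ (((pos , _) , _) , len) ∣π∣≡n →
  ℕ.<⇒≱ n<k (subst₂ _≤_ len ∣π∣≡n (length≤sum pos))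

-- Summation over the number of parts and comparison of coefficients

𝒟-series-total : ∀ K → weightedSeries (𝒟? ∩? λ π → length π ℕ.≤? K) (weight -½) ≗ partialSum T K
𝒟-series-total zero    n = series-cong (𝒟? ∩? λ π → length π ℕ.≤? 0) (𝒟#? 0) n
  (λ _ (d , len) → d , ℕ.n≤0⇒n≡0 len) (λ _ (d , len) → d , ℕ.≤-reflexive len) (λ _ → refl)
𝒟-series-total (suc K) n = trans
  (series-split 𝒟≤? short? (weight -½) n)
  (cong₂ _+_
    (trans (series-cong (𝒟≤? ∩? short?) (𝒟? ∩? short?) n
              (λ _ ((d , _) , len) → d , len) (λ _ (d , len) → (d , ℕ.m≤n⇒m≤1+n len) , len) (λ _ → refl))
           (𝒟-series-total K n))
    (series-cong (𝒟≤? ∩? ∁? short?) (𝒟#? (suc K)) n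
      (λ _ ((d , len) , ¬short) → d , ℕ.≤-antisym len (ℕ.≰⇒> ¬short))
      (λ _ (d , len) → (d , ℕ.≤-reflexive len) , ℕ.1+n≰n ∘ subst (_≤ K) len) (λ _ → refl)))
  where
  𝒟≤? = 𝒟? ∩? λ π → length π ℕ.≤? suc K
  short? : Decidable (λ (π : List ℕ) → length π ≤ K)
  short? π = length π ℕ.≤? K

𝒰-series-zero : 𝒰-series 0 ≗ T 0
𝒰-series-zero n = series-cong (𝒰≤? 0) (𝒟#? 0) n
  (λ { {[]} _ (u , _) → (u , []) , refl ; {_ ∷ _} _ ((x>0 ∷ _ , _) , x≤0 ∷ _) → contradiction x≤0 (ℕ.<⇒≱ x>0) })
  (λ { {[]} _ ((u , _) , _) → u , [] ; {_ ∷ _} _ (_ , ()) })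
  (λ { {[]} _ → refl ; {_ ∷ _} ((x>0 ∷ _ , _) , x≤0 ∷ _) → contradiction x≤0 (ℕ.<⇒≱ x>0) })

parts≤sum : ∀ π → All (_≤ ∣ π ∣) π
parts≤sum []      = []
parts≤sum (x ∷ π) = ℕ.m≤m+n x ∣ π ∣ ∷ All.map (λ y≤ → ℕ.≤-trans y≤ (ℕ.m≤n+m ∣ π ∣ x)) (parts≤sum π)

theorem4p2 : weightedSeries 𝒟? ω̃₁ ≗ weightedSeries 𝒰? ω₁′
theorem4p2 n = begin
  weightedSeries 𝒟? ω̃₁ n
    -- Positive parts: a partition of `n` has at most `n` of them.
    ≡⟨ series-cong 𝒟? (𝒟? ∩? λ π → length π ℕ.≤? n) n
         (λ ∣π∣≡n d → d , subst (_ ≤_) ∣π∣≡n (length≤sum (proj₁ (proj₁ d)))) (λ _ → proj₁)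
         (λ {π} _ → ω̃₁≗weight π) ⟩
  weightedSeries (𝒟? ∩? λ π → length π ℕ.≤? n) (weight -½) n
    ≡⟨ 𝒟-series-total n n ⟩
  partialSum T n n
    -- The choice N = n is large enough for the products to leave coefficient `n` unchanged.
    ≡⟨ partialSum-low T T-low n ℕ.≤-refl ℕ.≤-refl ⟨
  partialSum (term T n) n n
    ≡⟨ series-unique T T-rec 𝒰-series 𝒰-series-zero 𝒰-series-rec n n ⟨
  𝒰-series n n
    -- No part of a partition of `n` exceeds `n`.
    ≡⟨ series-cong (𝒰≤? n) 𝒰? n (λ _ → proj₁)
         (λ {π} ∣π∣≡n u → u , subst (λ m → All (_≤ m) π) ∣π∣≡n (parts≤sum π)) (λ _ → refl) ⟩
  weightedSeries 𝒰? ω₁′ n ∎
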